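{- Let $K$ be a field of characteristic different from $2$, let $\mathcal C$ be the conic section and $\ell:\mathcal C(K)\to\mathbb P^1(K)$ the linear rational map, defined over $K$, described in the context, and let $\mathrm{Disc}(t)$, $x_1(t),x_2(t),x_0(t)$ be the associated expressions. Consider those $t_0\in K$ such that $\sqrt{\mathrm{Disc}(t_0)}\in K$ and $$k=\frac{\mathrm{Disc}'(t_0)^2-2\,\mathrm{Disc}(t_0)\,\mathrm{Disc}''(t_0)}{\mathrm{Disc}'(t_0)^2}\neq 0,\,1,\,\infty .$$ Then for each $K$-rational point $(X:Y:1)$ on the elliptic curve $$\mathcal E_k:\quad Y^2+4XY+4kY=X^3+kX^2,$$ the set $\{P_1,P_2,P_3\}$ with $$P_1=\bigl(x_1(t_0-\delta):x_2(t_0-\delta):x_0(t_0-\delta)\bigr),$$ $$P_2=\bigl(x_1(t_0):x_2(t_0):x_0(t_0)\bigr),$$ $$P_3=\bigl(x_1(t_0+\delta):x_2(t_0+\delta):x_0(t_0+\delta)\bigr),$$ where $$\delta=-\frac{\mathrm{Disc}(t_0)}{\mathrm{Disc}'(t_0)}\cdot\frac{4XY}{Y^2+2XY+kX^2},$$ is contained in $\mathbb P^2(K)$ and forms an arithmetic progression on $\mathcal C$ with respect to $\ell$, with common difference $\delta=\ell(P_2)-\ell(P_1)=\ell(P_3)-\ell(P_2)$.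
   Context: The conic section is $$\mathcal C=\{(x_1:x_2:x_0)\in\mathbb P^2 : A x_1^2+2B x_1x_2+C x_2^2+2D x_1x_0+2E x_2x_0+F x_0^2=0\},$$ and the linear rational map $\ell:\mathcal C(K)\to\mathbb P^1(K)$ is $$\ell(x_1:x_2:x_0)=\frac{a x_1+b x_2+c x_0}{d x_1+e x_2+f x_0},$$ with coefficients $A,B,C,D,E,F,a,b,c,d,e,f\in K$. A set $\{P_1,P_2,P_3\}\subseteq\mathbb P^2(K)$ forms an arithmetic progression on $\mathcal C$ with respect to $\ell$ if each $P_i\in\mathcal C(K)$ and there is a common difference $\delta=\ell(P_2)-\ell(P_1)=\ell(P_3)-\ell(P_2)$. The discriminant is the polynomial in $t$ $$\mathrm{Disc}(t)=\begin{bmatrix}a-dt\\ b-et\\ c-ft\end{bmatrix}^T\begin{bmatrix}E^2-CF & BF-DE & CD-BE\\ BF-DE & D^2-AF & AE-BD\\ CD-BE & AE-BD & B^2-AC\end{bmatrix}\begin{bmatrix}a-dt\\ b-et\\ c-ft\end{bmatrix},$$ with $\mathrm{Disc}'$, $\mathrm{Disc}''$ its first and second derivatives in $t$. The condition $\sqrt{\mathrm{Disc}(t_0)}\in K$ means that $\mathrm{Disc}(t_0)$ is a square in $K$. The coordinates are $$x_1(t)=B(b-et)(c-ft)-C(a-dt)(c-ft)-D(b-et)^2+E(a-dt)(b-et)\pm(b-et)\sqrt{\mathrm{Disc}(t)},$$ $$x_2(t)=-A(b-et)(c-ft)+B(a-dt)(c-ft)+D(a-dt)(b-et)-E(a-dt)^2\mp(a-dt)\sqrt{\mathrm{Disc}(t)},$$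 $$x_0(t)=A(b-et)^2-2B(a-dt)(b-et)+C(a-dt)^2,$$ where the upper signs are taken together or the lower signs are taken together.
   Formalization: It is additionally assumed that the denominator Y²+2XY+kX² in δ is nonzero (it vanishes at (0,0), for example), and that none of the three coordinate triples defining P₁, P₂, P₃ is (0,0,0), which can happen and would not give a point of P²(K). -}

module Defs where

open import Level using (_⊔_)
open import Data.List.Base using (List; []; _∷_; map)
open import Data.Nat.Base using (ℕ; suc)
open import Data.Product.Base using (∃; proj₁)
open import Data.Sum.Base using (_⊎_)
open import Data.Vec.Base as Vec using (Vec; []; _∷_)
open import Algebra.Apartness.Bundles using (HeytingField; HeytingCommutativeRing)
open import Algebra.Bundles using (CommutativeRing)
import Algebra.Apartness.Properties.HeytingCommutativeRing as HeytingProperties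
import Algebra.Definitions.RawMonoid as RawMonoidDefinitions

-- The field is a `HeytingField`, and "x ≠ y" is its tight apartness x # y.
-- Classically these are exactly the fields, with # the negation of ≈
-- (and "x # 0" means "x is invertible" in any case).
module Over {κ r s} (K : HeytingField κ r s) where

  open HeytingField K
  open HeytingProperties heytingCommutativeRing using (x#0y#0→xy#0)
  open CommutativeRing (HeytingCommutativeRing.commutativeRing heytingCommutativeRing)
    using (+-rawMonoid)
  open RawMonoidDefinitions +-rawMonoid using () renaming (_×_ to _·_)

  2# 4# : Carrier
  2# = 1# + 1#
  4# = 2# + 2#

  infix 9 _²
  _² : Carrier → Carrier
  x ² = x * x

  IsSquare : Carrier → Set (κ ⊔ r)
  IsSquare x = ∃ λ w → w ² ≈ x

  -- `#⇒invertible` inverts y - 0#, which is ≈ y.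
  infixl 7 _/_[_]
  _/_[_] : (x y : Carrier) → y # 0# → Carrier
  x / y [ y#0 ] = x * proj₁ (#⇒invertible y#0)

  -- Coefficients listed with the constant term first.
  Poly : Set κ
  Poly = List Carrier

  const : Carrier → Poly
  const x = x ∷ []

  infixl 6 _+ₚ_
  infixl 7 _*ₚ_

  _+ₚ_ : Poly → Poly → Poly
  []      +ₚ q       = q
  (x ∷ p) +ₚ []      = x ∷ p
  (x ∷ p) +ₚ (y ∷ q) = (x + y) ∷ (p +ₚ q)

  _*ₚ_ : Poly → Poly → Poly
  []      *ₚ q = []
  (x ∷ p) *ₚ q = map (x *_) q +ₚ (0# ∷ (p *ₚ q))

  eval : Poly → Carrier → Carrier
  eval []      t = 0#
  eval (x ∷ p) t = x + t * eval p t

  -- n · x is the n-fold sum x + ⋯ + x.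
  derivative : Poly → Poly
  derivative []      = []
  derivative (_ ∷ p) = go 1 p
    where
    go : ℕ → Poly → Poly
    go n []      = []
    go n (x ∷ p) = (n · x) ∷ go (suc n) p

  dot : ∀ {n} → Vec Poly n → Vec Poly n → Poly
  dot u v = Vec.foldr′ _+ₚ_ [] (Vec.zipWith _*ₚ_ u v)

  -- vᵀ M v for a constant matrix M, given by its rows
  quadraticForm : ∀ {n} → Vec (Vec Carrier n) n → Vec Poly n → Poly
  quadraticForm M v = dot v (Vec.map (λ row → dot (Vec.map const row) v) M)

  NonZeroTriple : (x₁ x₂ x₀ : Carrier) → Set s
  NonZeroTriple x₁ x₂ x₀ = x₁ # 0# ⊎ x₂ # 0# ⊎ x₀ # 0#

  -- Homogeneous coordinates (x₁ : x₂ : x₀) of a point; the conic and the value of ℓ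
  -- do not depend on their scaling.
  record ℙ² : Set (κ ⊔ s) where
    field
      x₁ x₂ x₀ : Carrier
      nonZero  : NonZeroTriple x₁ x₂ x₀

  record Conic : Set κ where
    field A B C D E F : Carrier

  record LinearMap : Set κ where
    field a b c d e f : Carrier

  module _ (𝒞 : Conic) (ℓ : LinearMap) where

    open Conic 𝒞
    open LinearMap ℓ

    OnConic : ℙ² → Set r
    OnConic P =
      A * x₁ ² + 2# * B * x₁ * x₂ + C * x₂ ² + 2# * D * x₁ * x₀ + 2# * E * x₂ * x₀ + F * x₀ ²
        ≈ 0#
      where open ℙ² P

    -- ℓ P = (ℓ-num P : ℓ-den P) in ℙ¹.
    ℓ-num ℓ-den : ℙ² → Carrier
    ℓ-num P = a * x₁ + b * x₂ + c * x₀ where open ℙ² P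
    ℓ-den P = d * x₁ + e * x₂ + f * x₀ where open ℙ² P

    ℓ-value : (P : ℙ²) → ℓ-den P # 0# → Carrier
    ℓ-value P finite = ℓ-num P / ℓ-den P [ finite ]

    -- The differences of the values of ℓ make sense only when ℓ P₁, ℓ P₂
    -- and ℓ P₃ are defined and lie in K ⊆ ℙ¹(K).
    record IsArithmeticProgression (δ : Carrier) (P₁ P₂ P₃ : ℙ²) : Set (r ⊔ s) where
      field
        onConic₁ : OnConic P₁
        onConic₂ : OnConic P₂
        onConic₃ : OnConic P₃
        finite₁  : ℓ-den P₁ # 0#
        finite₂  : ℓ-den P₂ # 0#
        finite₃  : ℓ-den P₃ # 0#
        diff₁₂   : ℓ-value P₂ finite₂ - ℓ-value P₁ finite₁ ≈ δ
        diff₂₃   : ℓ-value P₃ finite₃ - ℓ-value P₂ finite₂ ≈ δ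

    discPoly : Poly
    discPoly = quadraticForm
      ( (E ² - C * F   ∷ B * F - D * E ∷ C * D - B * E ∷ [])
      ∷ (B * F - D * E ∷ D ² - A * F   ∷ A * E - B * D ∷ [])
      ∷ (C * D - B * E ∷ A * E - B * D ∷ B ² - A * C   ∷ [])
      ∷ [])
      ((a ∷ - d ∷ []) ∷ (b ∷ - e ∷ []) ∷ (c ∷ - f ∷ []) ∷ [])

    Disc Disc′ Disc″ : Carrier → Carrier
    Disc  = eval discPoly
    Disc′ = eval (derivative discPoly)
    Disc″ = eval (derivative (derivative discPoly))

    -- In the coordinates, w stands for a square root of Disc t. The formulas
    -- carry the upper signs; the lower signs are those for the root - w.
    module _ (t w : Carrier) where

      coord₁ coord₂ coord₀ : Carrier
      coord₁ = B * (b - e * t) * (c - f * t) - C * (a - d * t) * (c - f * t)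
             - D * (b - e * t) ² + E * (a - d * t) * (b - e * t)
             + (b - e * t) * w
      coord₂ = - (A * (b - e * t) * (c - f * t)) + B * (a - d * t) * (c - f * t)
             + D * (a - d * t) * (b - e * t) - E * (a - d * t) ²
             - (a - d * t) * w
      coord₀ = A * (b - e * t) ² - 2# * B * (a - d * t) * (b - e * t) + C * (a - d * t) ²

      -- The three coordinates can all vanish, and then give no point: if the
      -- line a x₁ + b x₂ + c x₀ = t (d x₁ + e x₂ + f x₀) is x₀ = 0, or for one
      -- of the two signs (both, if tangent) if it meets the conic on x₀ = 0.
      DefinesPoint : Set s
      DefinesPoint = NonZeroTriple coord₁ coord₂ coord₀

      point : DefinesPoint → ℙ²
      point nz = record { x₁ = coord₁ ; x₂ = coord₂ ; x₀ = coord₀ ; nonZero = nz }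

    k : (t₀ : Carrier) → Disc′ t₀ # 0# → Carrier
    k t₀ Disc′#0 =
      (Disc′ t₀ ² - 2# * Disc t₀ * Disc″ t₀) / Disc′ t₀ ² [ x#0y#0→xy#0 Disc′#0 Disc′#0 ]

    stepDenominator : (k X Y : Carrier) → Carrier
    stepDenominator k X Y = Y ² + 2# * X * Y + k * X ²

    step : (t₀ : Carrier) (Disc′#0 : Disc′ t₀ # 0#) (X Y : Carrier) →
           stepDenominator (k t₀ Disc′#0) X Y # 0# → Carrier
    step t₀ Disc′#0 X Y den#0 =
      - (Disc t₀ / Disc′ t₀ [ Disc′#0 ])
        * ((4# * X * Y) / stepDenominator (k t₀ Disc′#0) X Y [ den#0 ])

  -- The affine point (X : Y : 1) lies on ℰₖ.
  OnCurve : (k X Y : Carrier) → Set r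
  OnCurve k X Y = Y ² + 4# * X * Y + 4# * k * Y ≈ X * X ² + k * X ²

{-# OPTIONS --safe #-}
-- Each P_i lies on the line ℓ = t_i of the pencil spanned by p = (a, b, c) and
-- q = (d, e, f), and Disc is the dual conic restricted to this pencil.
--
-- Squares: Taylor expansion of the quadratic Disc gives, for s = ±δ,
--   Disc(t₀ + s) = Disc(t₀) ((S ∓ 2XY)² − 4kX²Y²) / S²,  S = Y² + 2XY + kX².
-- For s = δ the bracket is (Y² − kX²)² identically; for s = −δ it is
-- (2X³ − (Y² + 4XY − kX²))² by the equation of ℰₖ.
--
-- Finiteness of ℓ(P_i): if ℓ-den P_i were 0, then P_i would be the base point p × q
-- of the pencil, which would thus lie on 𝒞; but the discriminant of Disc, a
-- multiple of k, is −4 det(𝒞) 𝒞(p × q).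
module Submission where

open import Defs
open import Algebra.Apartness.Bundles using (HeytingField; HeytingCommutativeRing)
open import Algebra.Bundles using (CommutativeRing)
open import Algebra.Solver.Ring.AlmostCommutativeRing
  using (fromCommutativeRing; _-Raw-AlmostCommutative⟶_)
open import Data.Integer.Base as ℤ using (ℤ; +_; -[1+_])
open import Data.List.Base using ([]; _∷_; map)
open import Data.Nat.Base as ℕ using (ℕ; zero; suc)
open import Data.Product.Base using (_×_; _,_; ∃; proj₁; proj₂)
open import Data.Sum.Base using (inj₁; inj₂)
open import Data.Vec.Base using ([]; _∷_)
open import Relation.Binary.PropositionalEquality.Core as ≡ using (_≡_)
open import Relation.Nullary.Decidable.Core using (dec⇒maybe)
import Algebra.Apartness.Properties.HeytingCommutativeRing
import Algebra.Properties.AbelianGroup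
import Algebra.Properties.Ring
import Algebra.Properties.Semiring.Mult.TCOptimised
import Algebra.Solver.Ring
import Data.Integer.Properties as ℤ
import Data.Maybe.Base as Maybe
import Relation.Binary.Reasoning.Setoid

-- The ring solver needs coefficients with decidable equality, which an arbitrary
-- commutative ring lacks; integer coefficients are enough for all identities below.
module IntegerSolver {c ℓ} (R : CommutativeRing c ℓ) where

  open CommutativeRing R
  open Algebra.Properties.Ring ring
    using (-0#≈0#; -‿distribˡ-*; -‿distribʳ-*; -‿involutive)
  open Algebra.Properties.AbelianGroup +-abelianGroup using (⁻¹-∙-comm)
  open Algebra.Properties.Semiring.Mult.TCOptimised semiring
    using (1+×; ×-homo-+; ×1-homo-*) renaming (_×_ to infixl 8 _·_)
  open Relation.Binary.Reasoning.Setoid setoid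

  -- The optimised multiple makes 1 and 2 evaluate to `1#` and `1# + 1#` with no stray `0#`, so
  -- solver constants match the terms in the goals definitionally.
  fromℤ : ℤ → Carrier
  fromℤ (+ n)    = n · 1#
  fromℤ -[1+ n ] = - (suc n · 1#)

  fromℤ-cong : ∀ {i j} → i ≡ j → fromℤ i ≈ fromℤ j
  fromℤ-cong i≡j = reflexive (≡.cong fromℤ i≡j)

  fromℤ-neg : ∀ i → fromℤ (ℤ.- i) ≈ - fromℤ i
  fromℤ-neg (+ zero)  = sym -0#≈0#
  fromℤ-neg (+ suc n) = refl
  fromℤ-neg -[1+ n ]  = sym (-‿involutive _)

  fromℤ-⊖ : ∀ m n → fromℤ (m ℤ.⊖ n) ≈ m · 1# - n · 1#
  fromℤ-⊖ m       zero    = sym (trans (+-congˡ -0#≈0#) (+-identityʳ _))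
  fromℤ-⊖ zero    (suc n) = sym (+-identityˡ _)
  fromℤ-⊖ (suc m) (suc n) = begin
    fromℤ (suc m ℤ.⊖ suc n)                ≈⟨ fromℤ-cong (ℤ.[1+m]⊖[1+n]≡m⊖n m n) ⟩
    fromℤ (m ℤ.⊖ n)                        ≈⟨ fromℤ-⊖ m n ⟩
    -- Inserting 1 - 1 and regrouping raises both multiples by one.
    m · 1# - n · 1#                        ≈⟨ +-congʳ (+-identityʳ _) ⟨
    m · 1# + 0# - n · 1#                   ≈⟨ +-congʳ (+-congˡ (-‿inverseʳ 1#)) ⟨
    m · 1# + (1# - 1#) - n · 1#            ≈⟨ +-congʳ (+-assoc _ _ _) ⟨
    m · 1# + 1# - 1# - n · 1#              ≈⟨ +-assoc _ _ _ ⟩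
    m · 1# + 1# + (- 1# - n · 1#)          ≈⟨ +-cong (+-comm _ _) (⁻¹-∙-comm _ _) ⟩
    (1# + m · 1#) - (1# + n · 1#)          ≈⟨ +-cong (1+× m 1#) (-‿cong (1+× n 1#)) ⟨
    suc m · 1# - suc n · 1#                ∎

  fromℤ-+ : ∀ i j → fromℤ (i ℤ.+ j) ≈ fromℤ i + fromℤ j
  fromℤ-+ (+ m)    (+ n)    = ×-homo-+ 1# m n
  fromℤ-+ (+ m)    -[1+ n ] = fromℤ-⊖ m (suc n)
  fromℤ-+ -[1+ m ] (+ n)    = trans (fromℤ-⊖ n (suc m)) (+-comm _ _)
  fromℤ-+ -[1+ m ] -[1+ n ] = begin
    fromℤ (-[1+ m ] ℤ.+ -[1+ n ])          ≈⟨ fromℤ-cong (ℤ.neg-distrib-+ (+ suc m) (+ suc n)) ⟨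
    - ((suc m ℕ.+ suc n) · 1#)             ≈⟨ -‿cong (×-homo-+ 1# (suc m) (suc n)) ⟩
    - (suc m · 1# + suc n · 1#)            ≈⟨ ⁻¹-∙-comm _ _ ⟨
    - (suc m · 1#) - suc n · 1#            ∎

  fromℤ-*⁺ : ∀ m j → fromℤ (+ m ℤ.* j) ≈ m · 1# * fromℤ j
  fromℤ-*⁺ m (+ n) = trans (fromℤ-cong (≡.sym (ℤ.pos-* m n))) (×1-homo-* m n)
  fromℤ-*⁺ m -[1+ n ] = begin
    fromℤ (+ m ℤ.* (ℤ.- + suc n))          ≈⟨ fromℤ-cong (ℤ.neg-distribʳ-* (+ m) (+ suc n)) ⟨
    fromℤ (ℤ.- (+ m ℤ.* + suc n))          ≈⟨ fromℤ-neg (+ m ℤ.* + suc n) ⟩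
    - fromℤ (+ m ℤ.* + suc n)              ≈⟨ -‿cong (fromℤ-*⁺ m (+ suc n)) ⟩
    - (m · 1# * (suc n · 1#))              ≈⟨ -‿distribʳ-* _ _ ⟩
    m · 1# * - (suc n · 1#)                ∎

  fromℤ-* : ∀ i j → fromℤ (i ℤ.* j) ≈ fromℤ i * fromℤ j
  fromℤ-* (+ m)    j = fromℤ-*⁺ m j
  fromℤ-* -[1+ m ] j = begin
    fromℤ ((ℤ.- + suc m) ℤ.* j)            ≈⟨ fromℤ-cong (ℤ.neg-distribˡ-* (+ suc m) j) ⟨
    fromℤ (ℤ.- (+ suc m ℤ.* j))            ≈⟨ fromℤ-neg (+ suc m ℤ.* j) ⟩
    - fromℤ (+ suc m ℤ.* j)                ≈⟨ -‿cong (fromℤ-*⁺ (suc m) j) ⟩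
    - (suc m · 1# * fromℤ j)               ≈⟨ -‿distribˡ-* _ _ ⟩
    - (suc m · 1#) * fromℤ j               ∎

  fromℤ-morphism : ℤ.+-*-rawRing -Raw-AlmostCommutative⟶ fromCommutativeRing R
  fromℤ-morphism = record
    { ⟦_⟧    = fromℤ
    ; +-homo = fromℤ-+
    ; *-homo = fromℤ-*
    ; -‿homo = fromℤ-neg
    ; 0-homo = refl
    ; 1-homo = refl
    }

  open Algebra.Solver.Ring ℤ.+-*-rawRing (fromCommutativeRing R) fromℤ-morphism
    (λ i j → Maybe.map fromℤ-cong (dec⇒maybe (i ℤ.≟ j)))
    public

module ArithmeticProgressions {κ r s} (K : HeytingField κ r s) where

  open HeytingField K
  open Over K
  private
    commutativeRing = HeytingCommutativeRing.commutativeRing heytingCommutativeRing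
  open Algebra.Apartness.Properties.HeytingCommutativeRing heytingCommutativeRing
    using (x-0≈x; x#0y#0→xy#0; invertibleʳ⇒#; #-congʳ)
  open IntegerSolver commutativeRing
  open Relation.Binary.Reasoning.Setoid setoid

  private variable
    n : ℕ
    x y : Carrier

  -- Consequences of invertibility

  [_]⁻¹ : y # 0# → Carrier
  [ y#0 ]⁻¹ = proj₁ (#⇒invertible y#0)

  [_]⁻¹-inverse : (y#0 : y # 0#) → [ y#0 ]⁻¹ * y ≈ 1#
  [_]⁻¹-inverse {y} y#0 =
    trans (*-congˡ (sym (x-0≈x y))) (proj₁ (proj₂ (#⇒invertible y#0)))

  -- y times the inverse of xy is an inverse of x, and invertible elements are apart from 0.
  xy#0⇒x#0 : x * y # 0# → x # 0#
  xy#0⇒x#0 {x} {y} xy#0 = invertibleʳ⇒# (y * [ xy#0 ]⁻¹ , (begin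
    (x - 0#) * (y * [ xy#0 ]⁻¹)  ≈⟨ *-congʳ (x-0≈x x) ⟩
    x * (y * [ xy#0 ]⁻¹)         ≈⟨ solve 3 (λ x y z → x :* (y :* z) := z :* (x :* y)) refl x y [ xy#0 ]⁻¹ ⟩
    [ xy#0 ]⁻¹ * (x * y)         ≈⟨ [ xy#0 ]⁻¹-inverse ⟩
    1#                           ∎))

  xy#0⇒y#0 : x * y # 0# → y # 0#
  xy#0⇒y#0 xy#0 = xy#0⇒x#0 (#-congʳ (*-comm _ _) xy#0)

  x/y≈z : ∀ {z} (y#0 : y # 0#) → x ≈ z * y → x / y [ y#0 ] ≈ z
  x/y≈z {y} {x} {z} y#0 x≈zy = begin
    x * [ y#0 ]⁻¹        ≈⟨ *-congʳ x≈zy ⟩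
    z * y * [ y#0 ]⁻¹    ≈⟨ solve 3 (λ z y i → z :* y :* i := z :* (i :* y)) refl z y [ y#0 ]⁻¹ ⟩
    z * ([ y#0 ]⁻¹ * y)  ≈⟨ *-congˡ [ y#0 ]⁻¹-inverse ⟩
    z * 1#               ≈⟨ *-identityʳ z ⟩
    z                    ∎

  x/y*y≈x : (y#0 : y # 0#) → x / y [ y#0 ] * y ≈ x
  x/y*y≈x {y} {x} y#0 =
    trans (*-assoc x _ y) (trans (*-congˡ [ y#0 ]⁻¹-inverse) (*-identityʳ x))

  -- Lets a hypothesis y ≈ y′ enter a solver computation: the solver proves the goal up to a
  -- multiple of y - y′, which is dropped here.
  x+z[y-y′]≈x : ∀ {z y′} → y ≈ y′ → x + z * (y - y′) ≈ x
  x+z[y-y′]≈x {y} {x} {z} {y′} y≈y′ = begin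
    x + z * (y - y′)   ≈⟨ +-congˡ (*-congˡ (+-congʳ y≈y′)) ⟩
    x + z * (y′ - y′)  ≈⟨ solve 3 (λ x z y′ → x :+ z :* (y′ :- y′) := x) refl x z y′ ⟩
    x                  ∎

  ²-cong : x ≈ y → x ² ≈ y ²
  ²-cong x≈y = *-cong x≈y x≈y

  -- Evaluation of polynomials

  eval-cong : ∀ p → x ≈ y → eval p x ≈ eval p y
  eval-cong []      x≈y = refl
  eval-cong (_ ∷ p) x≈y = +-congˡ (*-cong x≈y (eval-cong p x≈y))

  eval-+ₚ : ∀ p q t → eval (p +ₚ q) t ≈ eval p t + eval q t
  eval-+ₚ []      q       t = sym (+-identityˡ _)
  eval-+ₚ (x ∷ p) []      t = sym (+-identityʳ _)
  eval-+ₚ (x ∷ p) (y ∷ q) t = begin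
    x + y + t * eval (p +ₚ q) t            ≈⟨ +-congˡ (*-congˡ (eval-+ₚ p q t)) ⟩
    x + y + t * (eval p t + eval q t)      ≈⟨ solve 5 (λ x y t u v → x :+ y :+ t :* (u :+ v) := x :+ t :* u :+ (y :+ t :* v))
                                                refl x y t (eval p t) (eval q t) ⟩
    x + t * eval p t + (y + t * eval q t)  ∎

  eval-scale : ∀ x p t → eval (map (x *_) p) t ≈ x * eval p t
  eval-scale x []      t = sym (zeroʳ x)
  eval-scale x (y ∷ p) t = begin
    x * y + t * eval (map (x *_) p) t  ≈⟨ +-congˡ (*-congˡ (eval-scale x p t)) ⟩
    x * y + t * (x * eval p t)         ≈⟨ solve 4 (λ x y t u → x :* y :+ t :* (x :* u) := x :* (y :+ t :* u)) refl x y t (eval p t) ⟩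
    x * (y + t * eval p t)             ∎

  eval-*ₚ : ∀ p q t → eval (p *ₚ q) t ≈ eval p t * eval q t
  eval-*ₚ []      q t = sym (zeroˡ _)
  eval-*ₚ (x ∷ p) q t = begin
    eval (map (x *_) q +ₚ (0# ∷ p *ₚ q)) t             ≈⟨ eval-+ₚ (map (x *_) q) _ t ⟩
    eval (map (x *_) q) t + (0# + t * eval (p *ₚ q) t) ≈⟨ +-cong (eval-scale x q t) (+-congˡ (*-congˡ (eval-*ₚ p q t))) ⟩
    x * eval q t + (0# + t * (eval p t * eval q t))    ≈⟨ solve 4 (λ x t u v → x :* v :+ (con (+ 0) :+ t :* (u :* v)) := (x :+ t :* u) :* v)
                                                            refl x t (eval p t) (eval q t) ⟩
    (x + t * eval p t) * eval q t                      ∎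

  -- The right-nested sum ending in `0#` is the shape to which the fold in `dot` unfolds.
  eval-dot : ∀ p₁ p₂ p₃ q₁ q₂ q₃ t →
    eval (dot (p₁ ∷ p₂ ∷ p₃ ∷ []) (q₁ ∷ q₂ ∷ q₃ ∷ [])) t ≈
    eval p₁ t * eval q₁ t + (eval p₂ t * eval q₂ t + (eval p₃ t * eval q₃ t + 0#))
  eval-dot p₁ p₂ p₃ q₁ q₂ q₃ t =
    trans (eval-+ₚ (p₁ *ₚ q₁) _ t) (+-cong (eval-*ₚ p₁ q₁ t)
      (trans (eval-+ₚ (p₂ *ₚ q₂) _ t) (+-cong (eval-*ₚ p₂ q₂ t)
        (trans (eval-+ₚ (p₃ *ₚ q₃) _ t) (+-congʳ (eval-*ₚ p₃ q₃ t))))))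

  -- Ternary quadratic forms and their duals

  conicForm : Conic → (x₁ x₂ x₀ : Carrier) → Carrier
  conicForm 𝒞 x₁ x₂ x₀ =
    A * x₁ ² + 2# * B * x₁ * x₂ + C * x₂ ² + 2# * D * x₁ * x₀ + 2# * E * x₂ * x₀ + F * x₀ ²
    where open Conic 𝒞

  -- The negated adjugate of the symmetric matrix of 𝒞. With b the polar form, its value at x × y is
  -- b(x, y)² - 𝒞(x)𝒞(y).
  dual : Conic → Conic
  dual 𝒞 = record
    { A = E ² - C * F ; B = B * F - D * E ; C = D ² - A * F
    ; D = C * D - B * E ; E = A * E - B * D ; F = B ² - A * C }
    where open Conic 𝒞

  det : Conic → Carrier
  det 𝒞 = A * C * F + 2# * B * D * E - A * E ² - C * D ² - F * B ²
    where open Conic 𝒞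

  :2 : Polynomial n
  :2 = con (+ 2)

  infix 9 _:²
  _:² : Polynomial n → Polynomial n
  x :² = x :* x

  -- This and `:dualForm` mirror `conicForm` and `dual` term by term, so that solved identities
  -- agree definitionally with the goals.
  :conicForm : (A B C D E F x₁ x₂ x₀ : Polynomial n) → Polynomial n
  :conicForm A B C D E F x₁ x₂ x₀ =
    A :* x₁ :² :+ :2 :* B :* x₁ :* x₂ :+ C :* x₂ :² :+ :2 :* D :* x₁ :* x₀ :+ :2 :* E :* x₂ :* x₀ :+ F :* x₀ :²

  :dualForm : (A B C D E F x₁ x₂ x₀ : Polynomial n) → Polynomial n
  :dualForm A B C D E F =
    :conicForm (E :² :- C :* F) (B :* F :- D :* E) (D :² :- A :* F)
      (C :* D :- B :* E) (A :* E :- B :* D) (B :² :- A :* C)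

  conicForm-cong : ∀ 𝒞 {x₁ x₂ x₀ y₁ y₂ y₀} → x₁ ≈ y₁ → x₂ ≈ y₂ → x₀ ≈ y₀ →
    conicForm 𝒞 x₁ x₂ x₀ ≈ conicForm 𝒞 y₁ y₂ y₀
  conicForm-cong 𝒞 p₁ p₂ p₀ =
    +-cong (+-cong (+-cong (+-cong (+-cong (*-congˡ (²-cong p₁)) (*-cong (*-congˡ p₁) p₂))
      (*-congˡ (²-cong p₂))) (*-cong (*-congˡ p₁) p₀)) (*-cong (*-congˡ p₂) p₀)) (*-congˡ (²-cong p₀))

  polarForm : Conic → (x₁ x₂ x₀ y₁ y₂ y₀ : Carrier) → Carrier
  polarForm 𝒞 x₁ x₂ x₀ y₁ y₂ y₀ =
    A * x₁ * y₁ + B * (x₁ * y₂ + x₂ * y₁) + C * x₂ * y₂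
      + D * (x₁ * y₀ + x₀ * y₁) + E * (x₂ * y₀ + x₀ * y₂) + F * x₀ * y₀
    where open Conic 𝒞

  conicForm-scale : ∀ 𝒞 μ x₁ x₂ x₀ →
    conicForm 𝒞 (μ * x₁) (μ * x₂) (μ * x₀) ≈ μ ² * conicForm 𝒞 x₁ x₂ x₀
  conicForm-scale 𝒞 = solve 10 (λ A B C D E F μ x₁ x₂ x₀ →
    :conicForm A B C D E F (μ :* x₁) (μ :* x₂) (μ :* x₀) := μ :² :* :conicForm A B C D E F x₁ x₂ x₀)
    refl A B C D E F
    where open Conic 𝒞

  -- Grouped so that ν divides all but the first summand: if x lies on the conic, the whole value is
  -- a multiple of ν.
  conicForm-expand : ∀ 𝒞 μ ν x₁ x₂ x₀ y₁ y₂ y₀ →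
    conicForm 𝒞 (μ * x₁ + ν * y₁) (μ * x₂ + ν * y₂) (μ * x₀ + ν * y₀) ≈
    μ ² * conicForm 𝒞 x₁ x₂ x₀
      + ν * (2# * μ * polarForm 𝒞 x₁ x₂ x₀ y₁ y₂ y₀ + ν * conicForm 𝒞 y₁ y₂ y₀)
  conicForm-expand 𝒞 = solve 14 (λ A B C D E F μ ν x₁ x₂ x₀ y₁ y₂ y₀ →
    :conicForm A B C D E F (μ :* x₁ :+ ν :* y₁) (μ :* x₂ :+ ν :* y₂) (μ :* x₀ :+ ν :* y₀) :=
    μ :² :* :conicForm A B C D E F x₁ x₂ x₀
      :+ ν :* (:2 :* μ :* (A :* x₁ :* y₁ :+ B :* (x₁ :* y₂ :+ x₂ :* y₁) :+ C :* x₂ :* y₂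
        :+ D :* (x₁ :* y₀ :+ x₀ :* y₁) :+ E :* (x₂ :* y₀ :+ x₀ :* y₂) :+ F :* x₀ :* y₀)
        :+ ν :* :conicForm A B C D E F y₁ y₂ y₀))
    refl A B C D E F
    where open Conic 𝒞

  -- Quadratic polynomials

  -- Degree at most two, as q₂ may vanish. Matching on `≡.refl` lets `eval` and `derivative` compute
  -- while the coefficients remain variables.
  IsQuadratic : Poly → Set κ
  IsQuadratic p = ∃ λ q₀ → ∃ λ q₁ → ∃ λ q₂ → p ≡ q₀ ∷ q₁ ∷ q₂ ∷ []

  -- The witness q is q₂, half the second derivative, obtained without dividing by 2.
  taylor : ∀ {p} → IsQuadratic p → ∃ λ q →
    (∀ t → eval (derivative (derivative p)) t ≈ 2# * q) ×
    (∀ t s → eval p (t + s) ≈ eval p t + s * eval (derivative p) t + s ² * q)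
  taylor (q₀ , q₁ , q₂ , ≡.refl) = q₂ ,
    -- The zeros reproduce how n-fold sums and `eval` unfold: 2 · q₂ is q₂ + (q₂ + 0), and
    -- evaluating a nonempty list ends in t * 0.
    solve 2 (λ q₂ t → (q₂ :+ (q₂ :+ :0)) :+ :0 :+ t :* :0 := :2 :* q₂) refl q₂ ,
    solve 5 (λ q₀ q₁ q₂ t s →
        :eval q₀ q₁ q₂ (t :+ s)
        := :eval q₀ q₁ q₂ t :+ s :* (q₁ :+ :0 :+ t :* (q₂ :+ (q₂ :+ :0) :+ t :* :0)) :+ s :² :* q₂)
      refl q₀ q₁ q₂
    where
    :0 : Polynomial n
    :0 = con (+ 0)
    :eval : (q₀ q₁ q₂ t : Polynomial n) → Polynomial n
    :eval q₀ q₁ q₂ t = q₀ :+ t :* (q₁ :+ t :* (q₂ :+ t :* :0))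

  -- The left-hand side is four times the discriminant of p, at every t.
  discriminant-from-values : ∀ {p} → IsQuadratic p → ∀ t →
    4# * (eval (derivative p) t ² - 2# * eval p t * eval (derivative (derivative p)) t) ≈
    (eval p 1# - eval p (- 1#)) ² - 4# * 2# * eval p 0# * (eval p 1# + eval p (- 1#) - 2# * eval p 0#)
  discriminant-from-values (q₀ , q₁ , q₂ , ≡.refl) = solve 4 (λ q₀ q₁ q₂ t → let
      :0 = con (+ 0)
      :1 = con (+ 1)
      :4 = :2 :+ :2
      v  = λ t → q₀ :+ t :* (q₁ :+ t :* (q₂ :+ t :* :0))
      v′ = q₁ :+ :0 :+ t :* (q₂ :+ (q₂ :+ :0) :+ t :* :0)
      v″ = (q₂ :+ (q₂ :+ :0)) :+ :0 :+ t :* :0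
    in :4 :* (v′ :² :- :2 :* v t :* v″) :=
       (v :1 :- v (:- :1)) :² :- :4 :* :2 :* v :0 :* (v :1 :+ v (:- :1) :- :2 :* v :0))
    refl q₀ q₁ q₂

  -- With D = p(t), k = (D′² - 2DD″)/D′² and s = -(D/D′)(2m/S), the value p(t + s) is
  -- D((S - m)² - km²)/S².
  eval-at-step : ∀ {p} → IsQuadratic p → ∀ t i j k m S → let
      D  = eval p t
      D′ = eval (derivative p) t
      D″ = eval (derivative (derivative p)) t
    in
    i * D′ ≈ 1# → j * S ≈ 1# → k * D′ ² ≈ D′ ² - 2# * D * D″ →
    eval p (t + - (D * i) * (2# * m * j)) ≈ D * j ² * ((S - m) ² - k * m ²)
  eval-at-step {p} quadratic t i j k m S iD′≈1 jS≈1 kD′²≈ = begin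
    eval p (t + - (D * i) * (2# * m * j))
      ≈⟨ proj₂ (proj₂ (taylor quadratic)) t _ ⟩
    D + - (D * i) * (2# * m * j) * D′ + (- (D * i) * (2# * m * j)) ² * q
      -- Regrouping exposes i * D′ and i² * (2D * 2q), which become 1 and 1 - k.
      ≈⟨ solve 6 (λ D i D′ m j q →
           D :+ :- (D :* i) :* (:2 :* m :* j) :* D′ :+ (:- (D :* i) :* (:2 :* m :* j)) :² :* q :=
           D :* (con (+ 1) :- (i :* D′) :* (:2 :* m :* j) :+ j :² :* m :² :* (i :² :* (:2 :* D :* (:2 :* q)))))
         refl D i D′ m j q ⟩
    D * (1# - (i * D′) * (2# * m * j) + j ² * m ² * (i ² * (2# * D * (2# * q))))
      ≈⟨ *-congˡ (+-cong (+-congˡ (-‿cong (*-congʳ iD′≈1))) (*-congˡ i²·2DD″≈1-k)) ⟩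
    D * (1# - 1# * (2# * m * j) + j ² * m ² * (1# - k))
      -- Here the factors 1 are turned back into (j * S)² and j * S, so that j² can be pulled out.
      ≈⟨ *-congˡ (+-congʳ (+-cong [jS]²≈1 (-‿cong (*-congʳ jS≈1)))) ⟨
    D * ((j * S) ² - (j * S) * (2# * m * j) + j ² * m ² * (1# - k))
      ≈⟨ solve 5 (λ D j S m k →
           D :* ((j :* S) :² :- (j :* S) :* (:2 :* m :* j) :+ j :² :* m :² :* (con (+ 1) :- k)) :=
           D :* j :² :* ((S :- m) :² :- k :* m :²))
         refl D j S m k ⟩
    D * j ² * ((S - m) ² - k * m ²) ∎
    where
    D  = eval p t
    D′ = eval (derivative p) t
    D″ = eval (derivative (derivative p)) t
    q  = proj₁ (taylor quadratic)
    [jS]²≈1 : (j * S) ² ≈ 1#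
    [jS]²≈1 = trans (²-cong jS≈1) (*-identityˡ 1#)
    i²·2DD″≈1-k : i ² * (2# * D * (2# * q)) ≈ 1# - k
    i²·2DD″≈1-k = begin
      i ² * (2# * D * (2# * q))
        ≈⟨ *-congˡ (*-congˡ (proj₁ (proj₂ (taylor quadratic)) t)) ⟨
      i ² * (2# * D * D″)
        ≈⟨ solve 3 (λ i² D′² W → i² :* W := i² :* (D′² :- (D′² :- W))) refl (i ²) (D′ ²) (2# * D * D″) ⟩
      i ² * (D′ ² - (D′ ² - 2# * D * D″))
        ≈⟨ *-congˡ (+-congˡ (-‿cong kD′²≈)) ⟨
      i ² * (D′ ² - k * D′ ²)
        ≈⟨ solve 3 (λ i D′ k → i :² :* (D′ :² :- k :* D′ :²) := (i :* D′) :² :* (con (+ 1) :- k)) refl i D′ k ⟩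
      (i * D′) ² * (1# - k)
        ≈⟨ *-congʳ (trans (²-cong iD′≈1) (*-identityˡ 1#)) ⟩
      1# * (1# - k)
        ≈⟨ *-identityˡ _ ⟩
      1# - k ∎

  -- Square roots of the stepped values

  square-root : ∀ {D j v w z} → w ² ≈ D → v ² ≈ z → (w * j * v) ² ≈ D * j ² * z
  square-root {D} {j} {v} {w} {z} w²≈D v²≈z = begin
    (w * j * v) ²      ≈⟨ solve 3 (λ w j v → (w :* j :* v) :² := w :² :* j :² :* v :²) refl w j v ⟩
    w ² * j ² * v ²    ≈⟨ *-cong (*-congʳ w²≈D) v²≈z ⟩
    D * j ² * z        ∎

  -- The right side exceeds the left by 4X³ times the difference of the two sides of the equation of
  -- ℰₖ. The bracket is taken at m = -2XY, whence the double negation.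
  backward-root : ∀ k X Y → OnCurve k X Y →
    (2# * (X * X ²) - (Y ² + 4# * X * Y - k * X ²)) ² ≈
    ((Y ² + 2# * X * Y + k * X ²) - - (2# * X * Y)) ² - k * (- (2# * X * Y)) ²
  backward-root k X Y onCurve = sym (trans
    (solve 3 (λ k X Y → let :4 = :2 :+ :2 in
        (Y :² :+ :2 :* X :* Y :+ k :* X :² :- :- (:2 :* X :* Y)) :² :- k :* (:- (:2 :* X :* Y)) :² :=
        (:2 :* (X :* X :²) :- (Y :² :+ :4 :* X :* Y :- k :* X :²)) :²
          :+ :4 :* (X :* X :²) :* (Y :² :+ :4 :* X :* Y :+ :4 :* k :* Y :- (X :* X :² :+ k :* X :²)))
      refl k X Y)
    (x+z[y-y′]≈x onCurve))

  -- S - 2XY is Y² + kX², and (Y² + kX²)² - 4kX²Y² = (Y² - kX²)².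
  forward-root : ∀ k X Y →
    (Y ² - k * X ²) ² ≈ ((Y ² + 2# * X * Y + k * X ²) - 2# * X * Y) ² - k * (2# * X * Y) ²
  forward-root = solve 3 (λ k X Y →
    (Y :² :- k :* X :²) :² :=
    (Y :² :+ :2 :* X :* Y :+ k :* X :² :- :2 :* X :* Y) :² :- k :* (:2 :* X :* Y) :²) refl

  -- The pencil of lines ℓ = t and its discriminant

  module _ (𝒞 : Conic) (ℓ : LinearMap) where

    open Conic 𝒞
    open LinearMap ℓ

    -- The lengths of the lists involved are fixed, so whatever the coefficients, a form in three
    -- linear entries computes to a list of three.
    discPoly-quadratic : IsQuadratic (discPoly 𝒞 ℓ)
    discPoly-quadratic = _ , _ , _ , ≡.refl

    -- Evaluation respects sums and products, so it commutes with forming vᵀMv. Identities involving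
    -- the conic use this closed form instead of the coefficient list.
    Disc≈dualForm : ∀ t → Disc 𝒞 ℓ t ≈ conicForm (dual 𝒞) (a - d * t) (b - e * t) (c - f * t)
    Disc≈dualForm t = begin
      Disc 𝒞 ℓ t
        ≈⟨ eval-dot u v z (row N.A N.B N.D) (row N.B N.C N.E) (row N.D N.E N.F) t ⟩
      _ ≈⟨ +-cong (*-congˡ (eval-row N.A N.B N.D)) (+-cong (*-congˡ (eval-row N.B N.C N.E))
             (+-congʳ (*-congˡ (eval-row N.D N.E N.F)))) ⟩
      _ ≈⟨ solve 13 (λ A B C D E F a b c d e f t → let
             lin = λ a d → a :+ t :* (:- d :+ t :* :0)
             con′ = λ x → x :+ t :* :0
             u = lin a d
             v = lin b e
             z = lin c f
             row = λ x y w → con′ x :* u :+ (con′ y :* v :+ (con′ w :* z :+ :0))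
           in u :* row A B D :+ (v :* row B C E :+ (z :* row D E F :+ :0)) :=
              :conicForm A B C D E F (a :- d :* t) (b :- e :* t) (c :- f :* t))
           refl N.A N.B N.C N.D N.E N.F a b c d e f t ⟩
      conicForm (dual 𝒞) (a - d * t) (b - e * t) (c - f * t) ∎
      where
      module N = Conic (dual 𝒞)
      :0 : Polynomial n
      :0 = con (+ 0)
      u = a ∷ - d ∷ []
      v = b ∷ - e ∷ []
      z = c ∷ - f ∷ []
      row : (x y w : Carrier) → Poly
      row x y w = dot (const x ∷ const y ∷ const w ∷ []) (u ∷ v ∷ z ∷ [])
      eval-row : ∀ x y w → eval (row x y w) t ≈
        eval (const x) t * eval u t + (eval (const y) t * eval v t + (eval (const w) t * eval z t + 0#))
      eval-row x y w = eval-dot (const x) (const y) (const w) u v z t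

    -- 𝒞 evaluated at the base point p × q of the pencil of lines ℓ = t
    baseValue : Carrier
    baseValue = conicForm 𝒞 (b * f - c * e) (c * d - a * f) (a * e - b * d)

    -- The adjugate of the negated adjugate is det(𝒞) times the matrix of 𝒞, which yields 𝒞(p × q).
    -- Working with the values of Disc at 0, 1 and -1 avoids its coefficients.
    discriminant≈baseValue : ∀ t →
      4# * (Disc′ 𝒞 ℓ t ² - 2# * Disc 𝒞 ℓ t * Disc″ 𝒞 ℓ t) ≈ - (4# ² * det 𝒞) * baseValue
    discriminant≈baseValue t = begin
      4# * (Disc′ 𝒞 ℓ t ² - 2# * Disc 𝒞 ℓ t * Disc″ 𝒞 ℓ t)
        ≈⟨ discriminant-from-values discPoly-quadratic t ⟩
      (Disc 𝒞 ℓ 1# - Disc 𝒞 ℓ (- 1#)) ²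
        - 4# * 2# * Disc 𝒞 ℓ 0# * (Disc 𝒞 ℓ 1# + Disc 𝒞 ℓ (- 1#) - 2# * Disc 𝒞 ℓ 0#)
        ≈⟨ +-cong (²-cong (+-cong D₊ (-‿cong D₋)))
             (-‿cong (*-cong (*-congˡ D₀) (+-cong (+-cong D₊ D₋) (-‿cong (*-congˡ D₀))))) ⟩
      _ ≈⟨ solve 12 (λ A B C D E F a b c d e f → let
             N  = λ t → :dualForm A B C D E F (a :- d :* t) (b :- e :* t) (c :- f :* t)
             D₀ = N (con (+ 0))
             D₊ = N (con (+ 1))
             D₋ = N (:- con (+ 1))
             :4 = :2 :+ :2
             Δ  = A :* C :* F :+ :2 :* B :* D :* E :- A :* E :² :- C :* D :² :- F :* B :²
           in (D₊ :- D₋) :² :- :4 :* :2 :* D₀ :* (D₊ :+ D₋ :- :2 :* D₀) :=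
              :- (:4 :² :* Δ) :* :conicForm A B C D E F (b :* f :- c :* e) (c :* d :- a :* f) (a :* e :- b :* d))
           refl A B C D E F a b c d e f ⟩
      - (4# ² * det 𝒞) * baseValue ∎
      where
      D₊ = Disc≈dualForm 1#
      D₋ = Disc≈dualForm (- 1#)
      D₀ = Disc≈dualForm 0#

    -- k is its numerator times an inverse, so k # 0 makes the numerator invertible and with it, as
    -- 4 = 2 * 2 is invertible, each factor on the right of `discriminant≈baseValue`.
    baseValue#0 : 2# # 0# → ∀ t (k≠∞ : Disc′ 𝒞 ℓ t # 0#) → k 𝒞 ℓ t k≠∞ # 0# → baseValue # 0#
    baseValue#0 2#0 t k≠∞ k#0 =
      xy#0⇒y#0 (#-congʳ (discriminant≈baseValue t) (x#0y#0→xy#0 4#0 (xy#0⇒x#0 k#0)))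
      where
      4#0 : 4# # 0#
      4#0 = #-congʳ (solve 0 (:2 :* :2 := :2 :+ :2) refl) (x#0y#0→xy#0 2#0 2#0)

    -- Points of 𝒞 on the line ℓ = t

    coord-onLine : ∀ t w → let u = a - d * t ; v = b - e * t ; z = c - f * t in
      u * coord₁ 𝒞 ℓ t w + v * coord₂ 𝒞 ℓ t w + z * coord₀ 𝒞 ℓ t w ≈ 0#
    coord-onLine t w = solve 10 (λ A B C D E F u v z w → let
        x₁ = B :* v :* z :- C :* u :* z :- D :* v :² :+ E :* u :* v :+ v :* w
        x₂ = :- (A :* v :* z) :+ B :* u :* z :+ D :* u :* v :- E :* u :² :- u :* w
        x₀ = A :* v :² :- :2 :* B :* u :* v :+ C :* u :²
      in u :* x₁ :+ v :* x₂ :+ z :* x₀ := con (+ 0))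
      refl A B C D E F (a - d * t) (b - e * t) (c - f * t) w

    -- `coord₀` is 𝒞 at the vector (v, -u, 0), which lies on the line (u, v, z) and on x₀ = 0; the
    -- second factor vanishes when w² = Disc(t).
    coord-conicForm : ∀ t w →
      conicForm 𝒞 (coord₁ 𝒞 ℓ t w) (coord₂ 𝒞 ℓ t w) (coord₀ 𝒞 ℓ t w) ≈
      coord₀ 𝒞 ℓ t w * (w ² - conicForm (dual 𝒞) (a - d * t) (b - e * t) (c - f * t))
    coord-conicForm t w = solve 10 (λ A B C D E F u v z w → let
        x₁ = B :* v :* z :- C :* u :* z :- D :* v :² :+ E :* u :* v :+ v :* w
        x₂ = :- (A :* v :* z) :+ B :* u :* z :+ D :* u :* v :- E :* u :² :- u :* w
        x₀ = A :* v :² :- :2 :* B :* u :* v :+ C :* u :²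
      in :conicForm A B C D E F x₁ x₂ x₀ := x₀ :* (w :² :- :dualForm A B C D E F u v z))
      refl A B C D E F (a - d * t) (b - e * t) (c - f * t) w

    point-onConic : ∀ t w → w ² ≈ Disc 𝒞 ℓ t → (P-defined : DefinesPoint 𝒞 ℓ t w) →
      OnConic 𝒞 ℓ (point 𝒞 ℓ t w P-defined)
    point-onConic t w w²≈Disc P-defined = begin
      conicForm 𝒞 (coord₁ 𝒞 ℓ t w) (coord₂ 𝒞 ℓ t w) (coord₀ 𝒞 ℓ t w)  ≈⟨ coord-conicForm t w ⟩
      coord₀ 𝒞 ℓ t w * (w ² - N)                                      ≈⟨ +-identityˡ _ ⟨
      0# + coord₀ 𝒞 ℓ t w * (w ² - N)                                 ≈⟨ x+z[y-y′]≈x (trans w²≈Disc (Disc≈dualForm t)) ⟩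
      0#                                                              ∎
      where N = conicForm (dual 𝒞) (a - d * t) (b - e * t) (c - f * t)

    -- Free of division, because invertibility of `ℓ-den` is itself deduced from this equation.
    point-ℓ : ∀ t w (P-defined : DefinesPoint 𝒞 ℓ t w) → let P = point 𝒞 ℓ t w P-defined in
      ℓ-num 𝒞 ℓ P ≈ t * ℓ-den 𝒞 ℓ P
    point-ℓ t w _ = begin
      a * x₁ + b * x₂ + c * x₀
        ≈⟨ solve 10 (λ a b c d e f t x₁ x₂ x₀ →
             a :* x₁ :+ b :* x₂ :+ c :* x₀ :=
             ((a :- d :* t) :* x₁ :+ (b :- e :* t) :* x₂ :+ (c :- f :* t) :* x₀)
               :+ t :* (d :* x₁ :+ e :* x₂ :+ f :* x₀)) refl a b c d e f t x₁ x₂ x₀ ⟩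
      ((a - d * t) * x₁ + (b - e * t) * x₂ + (c - f * t) * x₀) + t * (d * x₁ + e * x₂ + f * x₀)
        ≈⟨ +-congʳ (coord-onLine t w) ⟩
      0# + t * (d * x₁ + e * x₂ + f * x₀)
        ≈⟨ +-identityˡ _ ⟩
      t * (d * x₁ + e * x₂ + f * x₀) ∎
      where
      x₁ = coord₁ 𝒞 ℓ t w
      x₂ = coord₂ 𝒞 ℓ t w
      x₀ = coord₀ 𝒞 ℓ t w

    -- The vector identity (s·P)(p × q) = (s·(p × q))P + (q·P)(p × s) - (p·P)(q × s), together
    -- with p·P = t(q·P), shows that 𝒞((s·P)(p × q)) is a multiple of q·P.
    ℓ-den∣baseValue : ∀ (P : ℙ²) t → OnConic 𝒞 ℓ P → ℓ-num 𝒞 ℓ P ≈ t * ℓ-den 𝒞 ℓ P →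
      ∀ s₁ s₂ s₀ → let open ℙ² P in
      ∃ λ y → (s₁ * x₁ + s₂ * x₂ + s₀ * x₀) ² * baseValue ≈ ℓ-den 𝒞 ℓ P * y
    ℓ-den∣baseValue P t onConic num≈t·den s₁ s₂ s₀ = _ , (begin
      μ ² * baseValue
        ≈⟨ conicForm-scale 𝒞 μ _ _ _ ⟨
      conicForm 𝒞 (μ * (b * f - c * e)) (μ * (c * d - a * f)) (μ * (a * e - b * d))
        ≈⟨ conicForm-cong 𝒞
             (replace-num (solve 12 (λ a b c d e f s₁ s₂ s₀ x₁ x₂ x₀ →
               (s₁ :* x₁ :+ s₂ :* x₂ :+ s₀ :* x₀) :* (b :* f :- c :* e) :=
               (s₁ :* (b :* f :- c :* e) :+ s₂ :* (c :* d :- a :* f) :+ s₀ :* (a :* e :- b :* d)) :* x₁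
                 :+ ((d :* x₁ :+ e :* x₂ :+ f :* x₀) :* (b :* s₀ :- c :* s₂)
                   :- (a :* x₁ :+ b :* x₂ :+ c :* x₀) :* (e :* s₀ :- f :* s₂)))
               refl a b c d e f s₁ s₂ s₀ x₁ x₂ x₀))
             (replace-num (solve 12 (λ a b c d e f s₁ s₂ s₀ x₁ x₂ x₀ →
               (s₁ :* x₁ :+ s₂ :* x₂ :+ s₀ :* x₀) :* (c :* d :- a :* f) :=
               (s₁ :* (b :* f :- c :* e) :+ s₂ :* (c :* d :- a :* f) :+ s₀ :* (a :* e :- b :* d)) :* x₂
                 :+ ((d :* x₁ :+ e :* x₂ :+ f :* x₀) :* (c :* s₁ :- a :* s₀)
                   :- (a :* x₁ :+ b :* x₂ :+ c :* x₀) :* (f :* s₁ :- d :* s₀)))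
               refl a b c d e f s₁ s₂ s₀ x₁ x₂ x₀))
             (replace-num (solve 12 (λ a b c d e f s₁ s₂ s₀ x₁ x₂ x₀ →
               (s₁ :* x₁ :+ s₂ :* x₂ :+ s₀ :* x₀) :* (a :* e :- b :* d) :=
               (s₁ :* (b :* f :- c :* e) :+ s₂ :* (c :* d :- a :* f) :+ s₀ :* (a :* e :- b :* d)) :* x₀
                 :+ ((d :* x₁ :+ e :* x₂ :+ f :* x₀) :* (a :* s₂ :- b :* s₁)
                   :- (a :* x₁ :+ b :* x₂ :+ c :* x₀) :* (d :* s₂ :- e :* s₁)))
               refl a b c d e f s₁ s₂ s₀ x₁ x₂ x₀)) ⟩
      -- By now μ(p × q) is written as νP + den * y with y = p × s - t(q × s). Everything except
      -- ν²𝒞(P) carries den, and the cofactor is the witness.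
      _ ≈⟨ conicForm-expand 𝒞 ν den x₁ x₂ x₀ _ _ _ ⟩
      _ ≈⟨ +-congʳ (trans (*-congˡ onConic) (zeroʳ _)) ⟩
      _ ≈⟨ +-identityˡ _ ⟩
      den * _ ∎)
      where
      open ℙ² P
      den = ℓ-den 𝒞 ℓ P
      μ = s₁ * x₁ + s₂ * x₂ + s₀ * x₀
      ν = s₁ * (b * f - c * e) + s₂ * (c * d - a * f) + s₀ * (a * e - b * d)
      -- With p·P = t(q·P), both correction terms contain den.
      replace-num : ∀ {x y g h} → x ≈ y + (den * g - ℓ-num 𝒞 ℓ P * h) → x ≈ y + den * (g - t * h)
      replace-num {x} {y} {g} {h} x≈ = begin
        x                                    ≈⟨ x≈ ⟩
        y + (den * g - ℓ-num 𝒞 ℓ P * h)      ≈⟨ +-congˡ (+-congˡ (-‿cong (*-congʳ num≈t·den))) ⟩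
        y + (den * g - t * den * h)          ≈⟨ solve 5 (λ y m g t h → y :+ (m :* g :- t :* m :* h) := y :+ m :* (g :- t :* h)) refl y den g t h ⟩
        y + den * (g - t * h)                ∎

    -- Some coordinate of P is invertible. Taking s to be the matching unit vector makes s·P that
    -- coordinate, so (s·P)² times `baseValue` is invertible, and `ℓ-den` divides it.
    ℓ-den#0 : baseValue # 0# → ∀ (P : ℙ²) t → OnConic 𝒞 ℓ P →
      ℓ-num 𝒞 ℓ P ≈ t * ℓ-den 𝒞 ℓ P → ℓ-den 𝒞 ℓ P # 0#
    ℓ-den#0 base#0 P t onConic num≈t·den = cases nonZero
      where
      open ℙ² P
      :0 :1 : Polynomial n
      :0 = con (+ 0)
      :1 = con (+ 1)
      from : ∀ s₁ s₂ s₀ {y} → y ≈ s₁ * x₁ + s₂ * x₂ + s₀ * x₀ → y # 0# → ℓ-den 𝒞 ℓ P # 0#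
      from s₁ s₂ s₀ y≈s·P y#0 =
        xy#0⇒x#0 (#-congʳ (proj₂ (ℓ-den∣baseValue P t onConic num≈t·den s₁ s₂ s₀))
          (x#0y#0→xy#0 (x#0y#0→xy#0 s·P#0 s·P#0) base#0))
        where s·P#0 = #-congʳ y≈s·P y#0
      cases : NonZeroTriple x₁ x₂ x₀ → ℓ-den 𝒞 ℓ P # 0#
      cases (inj₁ x₁#0) = from 1# 0# 0#
        (solve 3 (λ x y z → x := :1 :* x :+ :0 :* y :+ :0 :* z) refl x₁ x₂ x₀) x₁#0
      cases (inj₂ (inj₁ x₂#0)) = from 0# 1# 0#
        (solve 3 (λ x y z → y := :0 :* x :+ :1 :* y :+ :0 :* z) refl x₁ x₂ x₀) x₂#0
      cases (inj₂ (inj₂ x₀#0)) = from 0# 0# 1#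
        (solve 3 (λ x y z → z := :0 :* x :+ :0 :* y :+ :1 :* z) refl x₁ x₂ x₀) x₀#0

    -- Valid for any δ: the line equations give ℓ the values t - δ, t and t + δ. The three roots are
    -- independent, so any choice of signs is covered.
    points-in-progression : baseValue # 0# → ∀ t δ w₁ w₂ w₃ →
      w₁ ² ≈ Disc 𝒞 ℓ (t - δ) → w₂ ² ≈ Disc 𝒞 ℓ t → w₃ ² ≈ Disc 𝒞 ℓ (t + δ) →
      (P₁-defined : DefinesPoint 𝒞 ℓ (t - δ) w₁)
      (P₂-defined : DefinesPoint 𝒞 ℓ t w₂)
      (P₃-defined : DefinesPoint 𝒞 ℓ (t + δ) w₃) →
      IsArithmeticProgression 𝒞 ℓ δ
        (point 𝒞 ℓ (t - δ) w₁ P₁-defined)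
        (point 𝒞 ℓ t w₂ P₂-defined)
        (point 𝒞 ℓ (t + δ) w₃ P₃-defined)
    points-in-progression base#0 t δ w₁ w₂ w₃ w₁² w₂² w₃² P₁ P₂ P₃ = record
      { onConic₁ = point-onConic (t - δ) w₁ w₁² P₁
      ; onConic₂ = point-onConic t w₂ w₂² P₂
      ; onConic₃ = point-onConic (t + δ) w₃ w₃² P₃
      ; finite₁  = finite (t - δ) w₁ w₁² P₁
      ; finite₂  = finite t w₂ w₂² P₂
      ; finite₃  = finite (t + δ) w₃ w₃² P₃
      ; diff₁₂   = trans (+-cong (value t w₂ w₂² P₂) (-‿cong (value (t - δ) w₁ w₁² P₁)))
          (solve 2 (λ t δ → t :- (t :- δ) := δ) refl t δ)
      ; diff₂₃   = trans (+-cong (value (t + δ) w₃ w₃² P₃) (-‿cong (value t w₂ w₂² P₂)))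
          (solve 2 (λ t δ → t :+ δ :- t := δ) refl t δ)
      }
      where
      finite : ∀ t w → w ² ≈ Disc 𝒞 ℓ t → (P : DefinesPoint 𝒞 ℓ t w) →
        ℓ-den 𝒞 ℓ (point 𝒞 ℓ t w P) # 0#
      finite t w w² P = ℓ-den#0 base#0 (point 𝒞 ℓ t w P) t (point-onConic t w w² P) (point-ℓ t w P)
      value : ∀ t w w² P → ℓ-value 𝒞 ℓ (point 𝒞 ℓ t w P) (finite t w w² P) ≈ t
      value t w w² P = x/y≈z (finite t w w² P) (point-ℓ t w P)

    -- Values of Disc one step away from t₀

    module _ (t₀ : Carrier) (Disc′#0 : Disc′ 𝒞 ℓ t₀ # 0#) (X Y : Carrier)
      (S#0 : stepDenominator 𝒞 ℓ (k 𝒞 ℓ t₀ Disc′#0) X Y # 0#) where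

      private
        k₀ = k 𝒞 ℓ t₀ Disc′#0
        S = stepDenominator 𝒞 ℓ k₀ X Y
        δ = step 𝒞 ℓ t₀ Disc′#0 X Y S#0
        D₀ = Disc 𝒞 ℓ t₀
        i = [ Disc′#0 ]⁻¹
        j = [ S#0 ]⁻¹

      -- m stays free: 2XY gives the step δ and -2XY gives -δ.
      Disc-at-multiple : ∀ m → Disc 𝒞 ℓ (t₀ + - (D₀ * i) * (2# * m * j)) ≈ D₀ * j ² * ((S - m) ² - k₀ * m ²)
      Disc-at-multiple m = eval-at-step discPoly-quadratic t₀ i j k₀ m S
        [ Disc′#0 ]⁻¹-inverse [ S#0 ]⁻¹-inverse (x/y*y≈x (x#0y#0→xy#0 Disc′#0 Disc′#0))

      Disc-forward : Disc 𝒞 ℓ (t₀ + δ) ≈ D₀ * j ² * ((S - 2# * X * Y) ² - k₀ * (2# * X * Y) ²)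
      Disc-forward = trans
        (eval-cong (discPoly 𝒞 ℓ) (+-congˡ (*-congˡ (*-congʳ
          (solve 2 (λ X Y → (:2 :+ :2) :* X :* Y := :2 :* (:2 :* X :* Y)) refl X Y)))))
        (Disc-at-multiple (2# * X * Y))

      Disc-backward : Disc 𝒞 ℓ (t₀ - δ) ≈ D₀ * j ² * ((S - - (2# * X * Y)) ² - k₀ * (- (2# * X * Y)) ²)
      Disc-backward = trans
        (eval-cong (discPoly 𝒞 ℓ) (+-congˡ
          (solve 4 (λ h X Y j → :- (:- h :* ((:2 :+ :2) :* X :* Y :* j)) := :- h :* (:2 :* :- (:2 :* X :* Y) :* j))
            refl (D₀ * i) X Y j)))
        (Disc-at-multiple (- (2# * X * Y)))

      Disc-squares : OnCurve k₀ X Y → IsSquare D₀ →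
        IsSquare (Disc 𝒞 ℓ (t₀ - δ)) × IsSquare D₀ × IsSquare (Disc 𝒞 ℓ (t₀ + δ))
      Disc-squares onCurve (w , w²≈D) =
        -- By `square-root` the witness is w * j times the root of the bracket, j being the inverse
        -- of S.
        (_ , trans (square-root w²≈D (backward-root k₀ X Y onCurve)) (sym Disc-backward)) ,
        (w , w²≈D) ,
        (_ , trans (square-root w²≈D (forward-root k₀ X Y)) (sym Disc-forward))

mainTheorem1 :
  ∀ {κ r s} (K : HeytingField κ r s) →
  let open HeytingField K
      open Over K
  in
  2# # 0# →
  (𝒞 : Conic) (ℓ : LinearMap) (t₀ : Carrier) →
  IsSquare (Disc 𝒞 ℓ t₀) →
  (k≠∞ : Disc′ 𝒞 ℓ t₀ # 0#) →
  k 𝒞 ℓ t₀ k≠∞ # 0# →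
  k 𝒞 ℓ t₀ k≠∞ # 1# →
  (X Y : Carrier) →
  OnCurve (k 𝒞 ℓ t₀ k≠∞) X Y →
  (δ-defined : stepDenominator 𝒞 ℓ (k 𝒞 ℓ t₀ k≠∞) X Y # 0#) →
  let δ = step 𝒞 ℓ t₀ k≠∞ X Y δ-defined
      t₁ = t₀ - δ
      t₂ = t₀
      t₃ = t₀ + δ
  in
  (IsSquare (Disc 𝒞 ℓ t₁) × IsSquare (Disc 𝒞 ℓ t₂) × IsSquare (Disc 𝒞 ℓ t₃)) ×
  (∀ w₁ w₂ w₃ →
   w₁ ² ≈ Disc 𝒞 ℓ t₁ →
   w₂ ² ≈ Disc 𝒞 ℓ t₂ →
   w₃ ² ≈ Disc 𝒞 ℓ t₃ →
   (P₁-defined : DefinesPoint 𝒞 ℓ t₁ w₁)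
   (P₂-defined : DefinesPoint 𝒞 ℓ t₂ w₂)
   (P₃-defined : DefinesPoint 𝒞 ℓ t₃ w₃) →
   IsArithmeticProgression 𝒞 ℓ δ
     (point 𝒞 ℓ t₁ w₁ P₁-defined)
     (point 𝒞 ℓ t₂ w₂ P₂-defined)
     (point 𝒞 ℓ t₃ w₃ P₃-defined))
mainTheorem1 K 2#0 𝒞 ℓ t₀ square k≠∞ k≠0 _ X Y onCurve δ-defined =
  Disc-squares 𝒞 ℓ t₀ k≠∞ X Y δ-defined onCurve square ,
  points-in-progression 𝒞 ℓ (baseValue#0 𝒞 ℓ 2#0 t₀ k≠∞ k≠0) t₀ _
  where open ArithmeticProgressions K
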